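{- For any constant-size tree $T$, $T$-freeness can be tested exactly (that is, without the property-testing relaxation) in $O(1)$ rounds in the CONGEST model: there is a randomized distributed algorithm running in $O(1)$ rounds (the constant depending only on $T$) such that if the network graph $G$ is $T$-free then with probability at least $2/3$ all nodes accept, and if $G$ contains $T$ as a subgraph then with probability at least $2/3$ some node rejects.
   Context: CONGEST model: the network is an undirected graph $G=(V,E)$ with $n=|V|$ nodes, nodes have unique $O(\log n)$-bit identifiers; computation is synchronous, and in each round every node may send $O(\log n)$ bits over each incident edge; nodes have private randomness. "Subgraph" means not-necessarily-induced subgraph. $G$ is $T$-free if it contains no subgraph isomorphic to $T$. -}

module Defs where

open import Data.Bool using (Bool; if_then_else_)
open import Data.Fin using (Fin; zero; suc)
open import Data.Fin.Properties using (all?; any?; ∀-cons)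
open import Data.List using (List; []; _∷_; _∷ʳ_; length)
open import Data.List.Relation.Unary.Linked using (Linked)
open import Data.List.Relation.Unary.Unique.Propositional using (Unique)
open import Data.Nat using (ℕ; zero; suc; _≤_; _<_; _*_; _^_)
open import Data.Nat.Logarithm using (⌈log₂_⌉)
open import Data.Product using (Σ-syntax; ∃-syntax; _×_; proj₁)
open import Data.Rational as ℚ using (ℚ; 0ℚ; 1ℚ; ½)
open import Function.Bundles using (_⇔_)
open import Function.Definitions using (Injective)
open import Level using (Level; 0ℓ)
open import Relation.Binary.Construct.Closure.ReflexiveTransitive using (Star)
open import Relation.Binary.Core using (Rel)
open import Relation.Binary.Definitions as B using (Symmetric; DecidableEquality)
open import Relation.Binary.PropositionalEquality using (_≡_; refl)
open import Relation.Nullary using (¬_; yes; no; does)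
open import Relation.Unary using (Pred; Decidable)

private
  variable
    ℓ   : Level
    X Y : Set
    k n : ℕ

------------------------------------------------------------------------
-- Graphs

record Graph (n : ℕ) : Set₁ where
  field
    Adj    : Rel (Fin n) 0ℓ
    adj?   : B.Decidable Adj
    sym    : Symmetric Adj
    irrefl : ∀ {v} → ¬ Adj v v

open Graph

-- A cycle is v, v₁, …, vₘ, v with m ≥ 2 and v, v₁, …, vₘ pairwise distinct.
IsCycle : Graph n → Fin n → List (Fin n) → Set
IsCycle G v vs = 2 ≤ length vs × Unique (v ∷ vs) × Linked (Adj G) (v ∷ vs ∷ʳ v)

record IsTree (G : Graph n) : Set where
  field
    nonempty  : 0 < n
    connected : ∀ u v → Star (Adj G) u v
    acyclic   : ∀ v vs → ¬ IsCycle G v vs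

-- Not necessarily induced.
record Subgraph (G : Graph n) : Set₁ where
  field
    Vertex : Pred (Fin n) 0ℓ
    Edge   : Rel (Fin n) 0ℓ
    sym    : Symmetric Edge
    ends   : ∀ {u v} → Edge u v → Vertex u × Vertex v
    sound  : ∀ {u v} → Edge u v → Adj G u v

-- f is required to be a bijection from the vertices of T onto the vertices
-- of H.
record _≅_ (T : Graph k) {G : Graph n} (H : Subgraph G) : Set where
  open Subgraph H
  field
    f          : Fin k → Fin n
    injective  : Injective _≡_ _≡_ f
    into       : ∀ i → Vertex (f i)
    onto       : ∀ {v} → Vertex v → ∃[ i ] f i ≡ v
    preserving : ∀ i j → Adj T i j ⇔ Edge (f i) (f j)

_Contains_ : Graph n → Graph k → Set₁
G Contains T = Σ[ H ∈ Subgraph G ] T ≅ H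

_FreeOf_ : Graph n → Graph k → Set₁
G FreeOf T = ¬ (G Contains T)

------------------------------------------------------------------------
-- Finite randomness: a binary tree of independent fair coin tosses.  The
-- number of tosses may depend on the outcomes of earlier ones.

data Rand (X : Set) : Set where
  return : X → Rand X
  toss   : Rand X → Rand X → Rand X

infixl 1 _>>=_

_>>=_ : Rand X → (X → Rand Y) → Rand Y
return x >>= f = f x
toss l r >>= f = toss (l >>= f) (r >>= f)

-- Independent experiments, one for each i : Fin n.
independently : {S : Fin n → Set} → (∀ i → Rand (S i)) → Rand (∀ i → S i)
independently {zero}      e = return λ ()
independently {suc n} {S} e =
  e zero >>= λ s →
  independently (λ i → e (suc i)) >>= λ ss →
  return (∀-cons {P = S} s ss)

Pr : {P : Pred X ℓ} → Decidable P → Rand X → ℚ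
Pr P? (return x) = if does (P? x) then 1ℚ else 0ℚ
Pr P? (toss l r) = ½ ℚ.* (Pr P? l ℚ.+ Pr P? r)

-- P holds for every outcome.
Surely : Pred X ℓ → Rand X → Set ℓ
Surely P (return x) = P x
Surely P (toss l r) = Surely P l × Surely P r

------------------------------------------------------------------------
-- The CONGEST model

-- The unit in which O(log n) bits are measured.  Using suc n in place of n
-- matters only for the degenerate n ≤ 1 and otherwise changes it by at most 1.
logBits : ℕ → ℕ
logBits n = ⌈log₂ suc n ⌉

-- A network on G: identifiers of at most b * logBits n bits, and at each node
-- an arbitrary numbering of its incident edges by ports.
record Network (b : ℕ) (G : Graph n) : Set where
  field
    ident       : Fin n → ℕ
    ident-inj   : Injective _≡_ _≡_ ident
    ident-bound : ∀ v → ident v < 2 ^ (b * logBits n)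
    deg         : Fin n → ℕ
    nbr         : ∀ v → Fin (deg v) → Fin n
    nbr-inj     : ∀ v → Injective _≡_ _≡_ (nbr v)
    nbr-adj     : ∀ v p → Adj G v (nbr v p)
    nbr-surj    : ∀ {u v} → Adj G u v → ∃[ p ] nbr u p ≡ v

  -- The port that leads back to v from the neighbour of v behind port p.
  back : ∀ v (p : Fin (deg v)) → Fin (deg (nbr v p))
  back v p = proj₁ (nbr-surj (Graph.sym G (nbr-adj v p)))

data Verdict : Set where
  accept reject : Verdict

_≟ᵛ_ : DecidableEquality Verdict
accept ≟ᵛ accept = yes refl
accept ≟ᵛ reject = no λ ()
reject ≟ᵛ accept = no λ ()
reject ≟ᵛ reject = yes refl

Message : Set
Message = List Bool

-- The program run by every node.  A node starts with its degree d and its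
-- identifier only (in particular it is not told n or its neighbours'
-- identifiers), and tosses private coins initially and in every round.
record Algorithm : Set₁ where
  field
    State   : (d : ℕ) → Set
    init    : ∀ d (ident : ℕ) → Rand (State d)
    send    : ∀ {d} → State d → Fin d → Message
    receive : ∀ {d} → State d → (Fin d → Message) → Rand (State d)
    output  : ∀ {d} → State d → Verdict

module Execution (A : Algorithm) {b : ℕ} {G : Graph n} (N : Network b G) where
  open Algorithm A
  open Network N

  Config : Set
  Config = ∀ v → State (deg v)

  round : Config → Rand Config
  round σ = independently λ v →
    receive (σ v) (λ p → send (σ (nbr v p)) (back v p))

  run : (rounds : ℕ) → Rand Config
  run zero    = independently λ v → init (deg v) (ident v)
  run (suc t) = run t >>= round

  AllAccept : Pred Config 0ℓ
  AllAccept σ = ∀ v → output (σ v) ≡ accept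

  SomeReject : Pred Config 0ℓ
  SomeReject σ = ∃[ v ] output (σ v) ≡ reject

  allAccept? : Decidable AllAccept
  allAccept? σ = all? λ v → output (σ v) ≟ᵛ accept

  someReject? : Decidable SomeReject
  someReject? σ = any? λ v → output (σ v) ≟ᵛ reject

  -- In each of the first R rounds, whatever the coins, every message fits
  -- into c * logBits n bits.
  Bandwidth : (R c : ℕ) → Set
  Bandwidth R c = ∀ t → t < R →
    Surely (λ σ → ∀ v p → length (send (σ v) p) ≤ c * logBits n) (run t)

{-# OPTIONS --safe #-}
module Submission where

-- No coins are needed.  Write T as a rooted tree built by grafting u below
-- the root of t.  An embedding of the grafted tree rooted at v is one of t at v
-- and a disjoint one of u at a neighbour of v, so the sets of identifiers
-- occupied by embeddings can be computed from the leaves up, with one exchange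
-- of messages per graft.  A node need not store all these sets: a bounded subfamily suffices
-- in which every set that is disjoint from some small Y can be exchanged for a
-- stored set disjoint from Y.  As T is acyclic, all its edges are
-- edges of the rooted tree, so embeddings of the latter are copies of T.

open import Defs
open import Data.Nat using (ℕ)
open import Data.Integer using (+_)
open import Data.Rational using (_/_; _≤_)
open import Data.Product using (Σ-syntax; ∃-syntax; _×_)

import Data.Nat as ℕ
import Data.Nat.Properties as ℕₚ
import Data.Rational as ℚ
import Data.Rational.Properties as ℚₚ
open import Data.Bool using (true; false)
open import Data.Empty using (⊥; ⊥-elim)
open import Data.Fin using (Fin; zero; suc; fromℕ<)
open import Data.Fin.Properties using () renaming (_≟_ to _≟ᶠ_)
open import Data.List using (List; []; _∷_; [_]; _∷ʳ_; _++_; length; map; filter; concatMap; allFin)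
open import Data.List.Membership.Propositional using (_∈_; _∉_; find; lose)
open import Data.List.Membership.Propositional.Properties
  using (∈-++⁺ˡ; ∈-++⁺ʳ; ∈-++⁻; ∈-map⁺; ∈-map⁻; ∈-concatMap⁺; ∈-concatMap⁻; ∈-filter⁺; ∈-filter⁻; ∈-allFin; ∈-AllPairs₂)
open import Data.List.Properties
  using (length-++; filter-notAll; map-++; map-cong-local; ++-assoc)
open import Data.List.Relation.Binary.Disjoint.Propositional using (Disjoint)
open import Data.List.Relation.Binary.Pointwise using (Pointwise; []; _∷_)
open import Data.List.Relation.Binary.Subset.Propositional using (_⊆_)
open import Data.List.Relation.Unary.All as All using (All; []; _∷_)
import Data.List.Relation.Unary.All.Properties as Allₚ
open import Data.List.Relation.Unary.AllPairs using ([]; _∷_)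
import Data.List.Relation.Unary.AllPairs.Properties as AllPairsₚ
open import Data.List.Relation.Unary.Any using (here; there; any?)
open import Data.List.Relation.Unary.Linked using (Linked; [-]; _∷_)
open import Data.List.Relation.Unary.Unique.Propositional using (Unique)
import Data.List.Relation.Unary.Unique.Propositional.Properties as Uniqueₚ
open import Data.Nat.Binary using (ℕᵇ; zero; 2[1+_]; 1+[2_]; fromℕ; toℕ; size)
open import Data.Nat.Binary.Properties using (toℕ-fromℕ; fromℕ-injective) renaming (_≟_ to _≟ᵇ_)
open import Data.Nat.GeneralisedArithmetic using (fold; fold-+)
open import Data.Nat.ListAction using (sum)
open import Data.Nat.Logarithm using (⌈log₂⌉-mono-≤)
open import Data.Product using (_,_; proj₁; proj₂; ∃₂)
open import Data.Sum using (_⊎_; inj₁; inj₂; [_,_]′)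
open import Data.Unit using (⊤; tt)
open import Function using (_∘_; mk⇔; Equivalence; case_of_)
open import Function.Definitions using (Injective)
open import Level using (Level)
open import Relation.Binary.Construct.Closure.ReflexiveTransitive using (Star; ε; _◅_)
open import Relation.Binary.PropositionalEquality
  using (_≡_; _≢_; refl; sym; trans; cong; cong₂; subst; module ≡-Reasoning)
open import Relation.Nullary using (¬_; Dec; yes; no; contradiction)
open import Relation.Nullary.Decidable using (¬?; from-yes)
open import Relation.Unary using (Pred; Decidable)

private
  variable
    ℓ ℓ′  : Level
    X Y L : Set
    k n   : ℕ

-- Randomness

Surely-mono : {P : Pred X ℓ} {Q : Pred X ℓ′} → (∀ {x} → P x → Q x) →
              ∀ r → Surely P r → Surely Q r
Surely-mono f (return x) p       = f p
Surely-mono f (toss l r) (p , q) = Surely-mono f l p , Surely-mono f r q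

Surely->>= : {P : Pred X ℓ} {Q : Pred Y ℓ′} {f : X → Rand Y} →
             (∀ {x} → P x → Surely Q (f x)) →
             ∀ r → Surely P r → Surely Q (r >>= f)
Surely->>= f (return x) p       = f p
Surely->>= f (toss l r) (p , q) = Surely->>= f l p , Surely->>= f r q

Surely-independently : ∀ {n} {S : Fin n → Set} {P : ∀ i → Pred (S i) ℓ}
                       (e : ∀ i → Rand (S i)) → (∀ i → Surely (P i) (e i)) →
                       Surely (λ s → ∀ i → P i (s i)) (independently e)
Surely-independently {n = ℕ.zero}  e p = λ ()
Surely-independently {n = ℕ.suc n} {P = P} e p =
  Surely->>= {P = P zero} (λ p₀ →
    Surely->>= (λ pₛ → λ { zero → p₀ ; (suc i) → pₛ i })
      (independently (e ∘ suc))
      (Surely-independently {P = P ∘ suc} (e ∘ suc) (p ∘ suc)))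
    (e zero) (p zero)

Surely⇒Pr≡1 : {P : Pred X ℓ} (P? : Decidable P) → ∀ r → Surely P r → Pr P? r ≡ ℚ.1ℚ
Surely⇒Pr≡1 P? (return x) p with P? x
... | yes _ = refl
... | no ¬p = contradiction p ¬p
Surely⇒Pr≡1 P? (toss l r) (p , q) =
  cong₂ (λ a b → ℚ.½ ℚ.* (a ℚ.+ b))
    (Surely⇒Pr≡1 P? l p) (Surely⇒Pr≡1 P? r q)

Surely⇒2/3≤Pr : {P : Pred X ℓ} (P? : Decidable P) → ∀ r → Surely P r → + 2 / 3 ≤ Pr P? r
Surely⇒2/3≤Pr P? r p =
  subst (+ 2 / 3 ≤_) (sym (Surely⇒Pr≡1 P? r p))
    (from-yes ((+ 2 / 3) ℚₚ.≤? ℚ.1ℚ))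

-- Families of sets of identifiers

Id : Set
Id = ℕᵇ

Family : Set
Family = List (List Id)

open import Data.List.Membership.DecPropositional _≟ᵇ_ using (_∈?_)

disjoint? : ∀ xs ys → Dec (Disjoint {A = Id} xs ys)
disjoint? xs ys with any? (_∈? ys) xs
... | yes p = no λ d → let _ , v∈xs , v∈ys = find p in d (v∈xs , v∈ys)
... | no ¬p = yes λ (v∈xs , v∈ys) → ¬p (lose v∈xs v∈ys)

length-concatMap : ∀ {A B : Set} (f : A → List B) {m} xs →
                   All (λ x → length (f x) ℕ.≤ m) xs →
                   length (concatMap f xs) ℕ.≤ length xs ℕ.* m
length-concatMap f []       []       = ℕ.z≤n
length-concatMap f {m} (x ∷ xs) (p ∷ ps) = begin
  length (f x ++ concatMap f xs)         ≡⟨ length-++ (f x) ⟩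
  length (f x) ℕ.+ length (concatMap f xs) ≤⟨ ℕₚ.+-mono-≤ p (length-concatMap f xs ps) ⟩
  m ℕ.+ length xs ℕ.* m                   ∎
  where open ℕₚ.≤-Reasoning

-- A set Y of at most q elements that meets S contains some s ∈ S; the members
-- of the family that avoid s then need only be tested against Y ∖ {s}.
represent : ℕ → Family → Family
represent q         []      = []
represent ℕ.zero    (S ∷ F) = S ∷ []
represent (ℕ.suc q) (S ∷ F) =
  S ∷ concatMap (λ s → represent q (filter (λ A → ¬? (s ∈? A)) F)) S

represent-⊆ : ∀ q F → represent q F ⊆ F
represent-⊆ q         []      ()
represent-⊆ ℕ.zero    (S ∷ F) (here e) = here e
represent-⊆ (ℕ.suc q) (S ∷ F) (here e) = here e
represent-⊆ (ℕ.suc q) (S ∷ F) (there A∈)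
  with find (∈-concatMap⁻ _ {xs = S} A∈)
... | s , _ , A∈ₛ = there (proj₁ (∈-filter⁻ _ (represent-⊆ q _ A∈ₛ)))

length-represent : ∀ {m} q F → All (λ A → length A ℕ.≤ m) F →
                   length (represent q F) ℕ.≤ ℕ.suc m ℕ.^ q
length-represent q         []      _ = ℕ.z≤n
length-represent ℕ.zero    (S ∷ F) _ = ℕₚ.≤-refl
-- Branching over at most `m` elements gives 1 + m (m + 1)^q ≤ (m + 1)^(q + 1), so the bound does
-- not depend on the length of `F`.
length-represent {m} (ℕ.suc q) (S ∷ F) (|S|≤m ∷ small) = ℕₚ.+-mono-≤
  (ℕₚ.m^n>0 (ℕ.suc m) q)
  (ℕₚ.≤-trans
    (length-concatMap _ S (All.tabulate λ {s} _ →
      length-represent q _ (Allₚ.filter⁺ (λ A → ¬? (s ∈? A)) small)))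
    (ℕₚ.*-monoˡ-≤ (ℕ.suc m ℕ.^ q) |S|≤m))

-- When the head meets `Y` in `s`, discarding the members that contain `s` loses nothing that avoids
-- `Y`. What survives avoids `s` by construction, which pays for dropping `s` from `Y`.
represent-complete : ∀ q F {A} Y → A ∈ F → length Y ℕ.≤ q → Disjoint A Y →
                     ∃[ B ] B ∈ represent q F × Disjoint B Y
represent-complete ℕ.zero (S ∷ F) [] A∈ _ _ = S , here refl , λ ()
represent-complete (ℕ.suc q) (S ∷ F) {A} Y A∈ |Y|≤q A#Y with any? (_∈? Y) S
... | no ¬p = S , here refl , λ (v∈S , v∈Y) → ¬p (lose v∈S v∈Y)
... | yes p with find p
... | s , s∈S , s∈Y =
  let B , B∈ , B#Y′ = represent-complete q F′ Y′ (in-F′ A∈) |Y′|≤q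
                        λ (v∈A , v∈Y′) → A#Y (v∈A , proj₁ (∈-filter⁻ ≢s? v∈Y′))
      s∉B = proj₂ (∈-filter⁻ avoids? {xs = F} (represent-⊆ q F′ B∈))
  in B , there (∈-concatMap⁺ _ (lose s∈S B∈)) ,
     λ (v∈B , v∈Y) → B#Y′ (v∈B , ∈-filter⁺ ≢s? v∈Y λ { refl → s∉B v∈B })
  where
  avoids? = λ B → ¬? (s ∈? B)
  ≢s?     = λ y → ¬? (y ≟ᵇ s)
  F′ = filter avoids? F
  Y′ = filter ≢s? Y
  |Y′|≤q : length Y′ ℕ.≤ q
  |Y′|≤q = ℕ.s≤s⁻¹ (ℕₚ.≤-trans (filter-notAll ≢s? Y (lose s∈Y λ s≢s → s≢s refl)) |Y|≤q)
  in-F′ : A ∈ S ∷ F → A ∈ F′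
  -- `A` cannot be the head, which meets `Y` in `s`.
  in-F′ (here refl) = ⊥-elim (A#Y (s∈S , s∈Y))
  in-F′ (there A∈F) = ∈-filter⁺ avoids? A∈F λ s∈A → A#Y (s∈A , s∈Y)

disjointUnions : Family → Family → Family
disjointUnions F G = concatMap (λ A → map (A ++_) (filter (disjoint? A) G)) F

∈-disjointUnions⁺ : ∀ {F G A B} → A ∈ F → B ∈ G → Disjoint A B → A ++ B ∈ disjointUnions F G
∈-disjointUnions⁺ {A = A} A∈F B∈G A#B =
  ∈-concatMap⁺ _ (lose A∈F (∈-map⁺ (A ++_) (∈-filter⁺ (disjoint? A) B∈G A#B)))

∈-disjointUnions⁻ : ∀ F G {C} → C ∈ disjointUnions F G →
                    ∃₂ λ A B → A ∈ F × B ∈ G × Disjoint A B × C ≡ A ++ B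
∈-disjointUnions⁻ F G C∈ with find (∈-concatMap⁻ _ {xs = F} C∈)
... | A , A∈F , C∈A with ∈-map⁻ (A ++_) C∈A
... | B , B∈ , refl with ∈-filter⁻ (disjoint? A) {xs = G} B∈
... | B∈G , A#B = A , B , A∈F , B∈G , A#B , refl

-- Encoding of families as messages

-- Every symbol takes two bits: 1b is a binary digit, 01 opens an identifier
-- and 00 opens a set.
encodeId : Id → Message
encodeId zero     = []
encodeId 2[1+ x ] = true ∷ true  ∷ encodeId x
encodeId 1+[2 x ] = true ∷ false ∷ encodeId x

encodeSet : List Id → Message
encodeSet = concatMap λ x → false ∷ true ∷ encodeId x

encode : Family → Message
encode = concatMap λ A → false ∷ false ∷ encodeSet A

-- Reads a message from its end; the first two components hold the identifier
-- and the set that have not been opened yet.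
parse : Message → Id × List Id × Family
parse (true  ∷ true  ∷ w) = let x , A , F = parse w in 2[1+ x ] , A , F
parse (true  ∷ false ∷ w) = let x , A , F = parse w in 1+[2 x ] , A , F
parse (false ∷ true  ∷ w) = let x , A , F = parse w in zero , x ∷ A , F
parse (false ∷ false ∷ w) = let x , A , F = parse w in zero , [] , A ∷ F
parse _                   = zero , [] , []

decode : Message → Family
decode w = proj₂ (proj₂ (parse w))

-- The digits of `x` are read on top of the pending identifier, so `w` has to leave `zero` pending.
-- In use `w` is empty or begins with an opening symbol, which resets it.
parse-encodeId : ∀ x {w A F} → parse w ≡ (zero , A , F) → parse (encodeId x ++ w) ≡ (x , A , F)
parse-encodeId zero     e = e
parse-encodeId 2[1+ x ] e rewrite parse-encodeId x e = refl
parse-encodeId 1+[2 x ] e rewrite parse-encodeId x e = refl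

parse-encodeSet : ∀ A {w F} → parse w ≡ (zero , [] , F) → parse (encodeSet A ++ w) ≡ (zero , A , F)
parse-encodeSet []      e = e
parse-encodeSet (x ∷ A) {w} e
  rewrite ++-assoc (encodeId x) (encodeSet A) w
        | parse-encodeId x (parse-encodeSet A e) = refl

parse-encode : ∀ F → parse (encode F) ≡ (zero , [] , F)
parse-encode []      = refl
parse-encode (A ∷ F) rewrite parse-encodeSet A (parse-encode F) = refl

decode-encode : ∀ F → decode (encode F) ≡ F
decode-encode F = cong (proj₂ ∘ proj₂) (parse-encode F)

-- In bijective base 2 the least number with s digits has all digits 1 and equals 2^s - 1.
2^size≤1+toℕ : ∀ x → 2 ℕ.^ size x ℕ.≤ ℕ.suc (toℕ x)
2^size≤1+toℕ zero     = ℕₚ.≤-refl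
2^size≤1+toℕ 2[1+ x ] = ℕₚ.≤-trans (ℕₚ.*-monoʳ-≤ 2 (2^size≤1+toℕ x)) (ℕₚ.n≤1+n _)
2^size≤1+toℕ 1+[2 x ] = ℕₚ.≤-trans (ℕₚ.*-monoʳ-≤ 2 (2^size≤1+toℕ x))
  (ℕₚ.≤-reflexive (ℕₚ.*-suc 2 (toℕ x)))

length-encodeId : ∀ x → length (encodeId x) ≡ 2 ℕ.* size x
length-encodeId zero     = refl
length-encodeId 2[1+ x ] = trans (cong (ℕ.suc ∘ ℕ.suc) (length-encodeId x)) (sym (ℕₚ.*-suc 2 (size x)))
length-encodeId 1+[2 x ] = trans (cong (ℕ.suc ∘ ℕ.suc) (length-encodeId x)) (sym (ℕₚ.*-suc 2 (size x)))

size-fromℕ : ∀ {i} m → i ℕ.< 2 ℕ.^ m → size (fromℕ i) ℕ.≤ m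
size-fromℕ {i} m i<2^m = ℕₚ.≮⇒≥ λ m<size →
  ℕₚ.<⇒≱ (ℕₚ.^-monoʳ-< 2 (ℕ.s≤s (ℕ.s≤s ℕ.z≤n)) m<size)
    (ℕₚ.≤-trans (2^size≤1+toℕ (fromℕ i))
      (subst (λ j → ℕ.suc j ℕ.≤ 2 ℕ.^ m) (sym (toℕ-fromℕ i)) i<2^m))

-- Each identifier costs one opening symbol and one symbol per digit, at two bits a symbol.
length-encodeSet : ∀ {m} A → All (λ x → size x ℕ.≤ m) A →
                   length (encodeSet A) ℕ.≤ length A ℕ.* (2 ℕ.+ 2 ℕ.* m)
length-encodeSet A small = length-concatMap _ A
  (All.map (λ {x} |x|≤m → ℕ.s≤s (ℕ.s≤s
     (ℕₚ.≤-trans (ℕₚ.≤-reflexive (length-encodeId x)) (ℕₚ.*-monoʳ-≤ 2 |x|≤m)))) small)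

length-encode : ∀ {m s} F → All (λ A → length A ℕ.≤ s × All (λ x → size x ℕ.≤ m) A) F →
                length (encode F) ℕ.≤ length F ℕ.* (2 ℕ.+ s ℕ.* (2 ℕ.+ 2 ℕ.* m))
length-encode F small = length-concatMap _ F
  (All.map (λ {A} (|A|≤s , bits) → ℕ.s≤s (ℕ.s≤s
     (ℕₚ.≤-trans (length-encodeSet A bits) (ℕₚ.*-monoˡ-≤ _ |A|≤s)))) small)

-- Rooted trees

-- graft t u hangs u below the root of t.
data Tree (L : Set) : Set where
  leaf  : L → Tree L
  graft : Tree L → Tree L → Tree L

root : Tree L → L
root (leaf x)    = x
root (graft t _) = root t

labels : Tree L → List L
labels (leaf x)    = x ∷ []
labels (graft t u) = labels t ++ labels u

order : Tree L → ℕ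
order (leaf _)    = 1
order (graft t u) = order t ℕ.+ order u

-- The child comes second.
Edge : Tree L → L → L → Set
Edge (leaf _)    x y = ⊥
Edge (graft t u) x y = Edge t x y ⊎ Edge u x y ⊎ (x ≡ root t × y ≡ root u)

Separated : Tree L → Set
Separated (leaf _)    = ⊤
Separated (graft t u) = Separated t × Separated u × Disjoint (labels t) (labels u)

root∈labels : (t : Tree L) → root t ∈ labels t
root∈labels (leaf _)    = here refl
root∈labels (graft t _) = ∈-++⁺ˡ (root∈labels t)

Edge⇒∈labels : ∀ (t : Tree L) {x y} → Edge t x y → x ∈ labels t × y ∈ labels t
Edge⇒∈labels (graft t u) (inj₁ e) =
  let x∈ , y∈ = Edge⇒∈labels t e in ∈-++⁺ˡ x∈ , ∈-++⁺ˡ y∈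
Edge⇒∈labels (graft t u) (inj₂ (inj₁ e)) =
  let x∈ , y∈ = Edge⇒∈labels u e in ∈-++⁺ʳ (labels t) x∈ , ∈-++⁺ʳ (labels t) y∈
Edge⇒∈labels (graft t u) (inj₂ (inj₂ (refl , refl))) =
  ∈-++⁺ˡ (root∈labels t) , ∈-++⁺ʳ (labels t) (root∈labels u)

-- Trees as stack programs

data Instr (L : Set) : Set where
  push : L → Instr L
  join : Instr L

-- Polymorphic in the stack entries, so that the symbolic run on trees and the nodes' runs on
-- families are runs of the same machine. A `join` with fewer than two entries is skipped to keep it
-- total.
step : (L → X) → (X → X → X) → List (Instr L) × List X → List (Instr L) × List X
step f g ([]         , s)         = [] , s
step f g (push x ∷ p , s)         = p , f x ∷ s
step f g (join   ∷ p , y ∷ x ∷ s) = p , g x y ∷ s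
step f g (join   ∷ p , s)         = p , s

-- The child `u` is evaluated last: when `join` is executed, its family is on top of the stack, and
-- the top is what the neighbours send. The argument `p` is the program that follows.
compile : Tree L → List (Instr L) → List (Instr L)
compile (leaf x)    p = push x ∷ p
compile (graft t u) p = compile t (compile u (join ∷ p))

-- One step per instruction; the addends stand in the order of `fold-+`, the later phase first.
time : Tree L → ℕ
time (leaf _)    = 1
time (graft t u) = 1 ℕ.+ (time u ℕ.+ time t)

stepTree : List (Instr L) × List (Tree L) → List (Instr L) × List (Tree L)
stepTree = step leaf graft

compile-correct : ∀ (t : Tree L) p s → fold (compile t p , s) stepTree (time t) ≡ (p , t ∷ s)
compile-correct (leaf x)    p s = refl
compile-correct (graft t u) p s = begin
  stepTree (fold start stepTree (time u ℕ.+ time t))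
    ≡⟨ cong stepTree (fold-+ start stepTree (time u)) ⟩
  stepTree (fold (fold start stepTree (time t)) stepTree (time u))
    ≡⟨ cong (λ z → stepTree (fold z stepTree (time u))) (compile-correct t _ s) ⟩
  stepTree (fold (compile u (join ∷ p) , t ∷ s) stepTree (time u))
    ≡⟨ cong stepTree (compile-correct u _ (t ∷ s)) ⟩
  p , graft t u ∷ s ∎
  where
  open ≡-Reasoning
  start = compile (graft t u) p , s

orders : List (Tree L) → ℕ
orders = sum ∘ map order

orders-step : ∀ (z : List (Instr L) × List (Tree L)) →
              orders (proj₂ (stepTree z)) ℕ.≤ ℕ.suc (orders (proj₂ z))
orders-step ([]         , s)         = ℕₚ.n≤1+n _
orders-step (push x ∷ p , s)         = ℕₚ.≤-refl
orders-step (join   ∷ p , [])        = ℕ.z≤n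
orders-step (join   ∷ p , _ ∷ [])    = ℕₚ.n≤1+n _
orders-step (join   ∷ p , u ∷ t ∷ s) = ℕₚ.m≤n⇒m≤1+n (ℕₚ.≤-reflexive
  (trans (cong (ℕ._+ orders s) (ℕₚ.+-comm (order t) (order u)))
         (ℕₚ.+-assoc (order u) (order t) (orders s))))

-- A `push` adds one vertex to the stack and a `join` only merges, so the number of steps bounds the
-- order of every tree on it, and thereby the size of the transmitted sets.
orders-fold : ∀ (p : List (Instr L)) r →
              orders (proj₂ (fold (p , []) stepTree r)) ℕ.≤ r
orders-fold p ℕ.zero    = ℕ.z≤n
orders-fold p (ℕ.suc r) =
  ℕₚ.≤-trans (orders-step (fold (p , []) stepTree r)) (ℕ.s≤s (orders-fold p r))

-- The algorithm

top : List Family → Family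
top []      = []
top (F ∷ _) = F

verdict : Family → Verdict
verdict []      = accept
verdict (_ ∷ _) = reject

record Memory (L : Set) : Set where
  constructor memory
  field
    self    : Id
    machine : List (Instr L) × List Family

  current : Family
  current = top (proj₂ machine)

open Memory

-- The nodes execute the same program in lockstep.  Its symbolic value at a
-- time is a stack of trees; node v stores for each tree t of the stack
-- a q-representative family of the identifier sets of embeddings that
-- map the root of t to v.
detector : List (Instr L) → ℕ → Algorithm
detector {L = L} p q = record
  { State   = λ _ → Memory L
  ; init    = λ _ i → return (memory (fromℕ i) (p , []))
  ; send    = λ σ _ → encode (current σ)
  ; receive = λ {d} σ msgs → return (memory (self σ)
      (step (λ _ → [ [ self σ ] ])
            (λ F _ → represent q (disjointUnions F (concatMap (decode ∘ msgs) (allFin d))))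
            (machine σ)))
  ; output  = verdict ∘ current
  }

-- At most `suc q ^ q` sets of at most `q` identifiers, each identifier of at most `b * logBits n`
-- digits, with the factor `logBits n` taken out.
messageBits : ℕ → ℕ → ℕ
messageBits q b = ℕ.suc q ℕ.^ q ℕ.* (2 ℕ.+ q ℕ.* (2 ℕ.+ 2 ℕ.* b))

-- The given node excludes `n ≡ 0`, where `logBits` vanishes.
1≤logBits : Fin n → 1 ℕ.≤ logBits n
1≤logBits {ℕ.suc n} _ = ⌈log₂⌉-mono-≤ {2} {ℕ.suc (ℕ.suc n)} (ℕ.s≤s (ℕ.s≤s ℕ.z≤n))

-- Embeddings of rooted trees and the families representing them

module Correctness {b n} {G : Graph n} (N : Network b G) where
  open Network N

  code : Fin n → Id
  code = fromℕ ∘ ident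

  code-injective : Injective _≡_ _≡_ code
  code-injective = ident-inj ∘ fromℕ-injective

  -- A lists the identifiers of an embedded copy of t, in the order of labels t.
  data Embeds {L : Set} : Tree L → Fin n → List Id → Set where
    leaf  : ∀ x v → Embeds (leaf x) v [ code v ]
    graft : ∀ {t u v w A B} → Embeds t v A → Embeds u w B →
            Graph.Adj G v w → Disjoint A B → Embeds (graft t u) v (A ++ B)

  length-Embeds : ∀ {t : Tree L} {v A} → Embeds t v A → length A ≡ order t
  length-Embeds (leaf x v) = refl
  length-Embeds (graft {A = A} e₁ e₂ _ _) =
    trans (length-++ A) (cong₂ ℕ._+_ (length-Embeds e₁) (length-Embeds e₂))

  Embeds-codes : ∀ {t : Tree L} {v A} → Embeds t v A → All (λ x → ∃[ w ] x ≡ code w) A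
  Embeds-codes (leaf x v)        = (v , refl) ∷ []
  Embeds-codes (graft e₁ e₂ _ _) = Allₚ.++⁺ (Embeds-codes e₁) (Embeds-codes e₂)

  Embeds-unique : ∀ {t : Tree L} {v A} → Embeds t v A → Unique A
  Embeds-unique (leaf x v)          = [] ∷ []
  Embeds-unique (graft e₁ e₂ _ A#B) = Uniqueₚ.++⁺ (Embeds-unique e₁) (Embeds-unique e₂) A#B

  -- The budget `q` covers `Y` together with the vertices of `t`; at a graft, the identifiers of one
  -- part can therefore be added to the set that the other part has to avoid. The bound `small` is
  -- free of `n`, which keeps messages short.
  record Represents {L : Set} (q : ℕ) (v : Fin n) (t : Tree L) (F : Family) : Set where
    field
      sound    : ∀ {A} → A ∈ F → Embeds t v A
      small    : length F ℕ.≤ ℕ.suc (order t) ℕ.^ q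
      complete : ∀ {A} Y → Embeds t v A → length Y ℕ.+ order t ℕ.≤ q → Disjoint A Y →
                 ∃[ B ] B ∈ F × Disjoint B Y

  open Represents

  leaf-represents : ∀ {q v} (x : L) → Represents q v (leaf x) [ [ code v ] ]
  leaf-represents {q = q} {v} x = record
    { sound    = λ { (here refl) → leaf x v }
    ; small    = ℕₚ.m^n>0 2 q
    ; complete = λ { Y (leaf _ _) _ A#Y → _ , here refl , A#Y }
    }

  graft-represents : ∀ {q v} {t u : Tree L} {F} {H : Fin (deg v) → Family} →
    Represents q v t F → (∀ p → Represents q (nbr v p) u (H p)) →
    Represents q v (graft t u) (represent q (disjointUnions F (concatMap H (allFin (deg v)))))
  graft-represents {q = q} {v} {t} {u} {F} {H} rF rH = record
    { sound    = λ C∈ → candidate-sound (represent-⊆ q candidates C∈)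
    ; small    = length-represent q candidates
                   (All.tabulate (ℕₚ.≤-reflexive ∘ length-Embeds ∘ candidate-sound))
    ; complete = complete′
    }
    where
    Hs = concatMap H (allFin (deg v))
    candidates = disjointUnions F Hs

    candidate-sound : ∀ {C} → C ∈ candidates → Embeds (graft t u) v C
    candidate-sound C∈ with ∈-disjointUnions⁻ F Hs C∈
    ... | A , B , A∈F , B∈Hs , A#B , refl
      with find (∈-concatMap⁻ H {xs = allFin (deg v)} B∈Hs)
    ... | p , _ , B∈H = graft (sound rF A∈F) (sound (rH p) B∈H) (nbr-adj v p) A#B

    -- First B is exchanged for a represented B′ avoiding A and Y, then A for
    -- a represented A′ avoiding B′ and Y.
    complete′ : ∀ {C} Y → Embeds (graft t u) v C →
                length Y ℕ.+ (order t ℕ.+ order u) ℕ.≤ q → Disjoint C Y →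
                ∃[ D ] D ∈ represent q candidates × Disjoint D Y
    complete′ Y (graft {A = A} {B} eA eB v~w A#B) fits C#Y with nbr-surj v~w
    ... | p , refl =
      let B′ , B′∈ , B′#YA = complete (rH p) (Y ++ A) eB
            (ℕₚ.≤-trans (ℕₚ.≤-reflexive sizeB) fits)
            λ (x∈B , x∈YA) → [ (λ x∈Y → C#Y (∈-++⁺ʳ A x∈B , x∈Y))
                             , (λ x∈A → A#B (x∈A , x∈B)) ]′ (∈-++⁻ Y x∈YA)
          -- By soundness `B′` has `order u` elements, as `B` has, so the exchange leaves the budget
          -- intact.
          A′ , A′∈ , A′#YB = complete rF (Y ++ B′) eA
            (ℕₚ.≤-trans (ℕₚ.≤-reflexive (sizeA (length-Embeds (sound (rH p) B′∈)))) fits)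
            λ (x∈A , x∈YB) → [ (λ x∈Y → C#Y (∈-++⁺ˡ x∈A , x∈Y))
                             , (λ x∈B → B′#YA (x∈B , ∈-++⁺ʳ Y x∈A)) ]′ (∈-++⁻ Y x∈YB)
      in represent-complete q candidates Y
           (∈-disjointUnions⁺ A′∈ (∈-concatMap⁺ H (lose (∈-allFin p) B′∈))
             λ (x∈A′ , x∈B′) → A′#YB (x∈A′ , ∈-++⁺ʳ Y x∈B′))
           (ℕₚ.≤-trans (ℕₚ.m≤m+n _ _) fits)
           λ (x∈ , x∈Y) → [ (λ x∈A′ → A′#YB (x∈A′ , ∈-++⁺ˡ x∈Y))
                          , (λ x∈B′ → B′#YA (x∈B′ , ∈-++⁺ˡ x∈Y)) ]′ (∈-++⁻ A′ x∈)
      where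
      sizeB : length (Y ++ A) ℕ.+ order u ≡ length Y ℕ.+ (order t ℕ.+ order u)
      sizeB = trans
        (cong (ℕ._+ order u) (trans (length-++ Y) (cong (length Y ℕ.+_) (length-Embeds eA))))
        (ℕₚ.+-assoc (length Y) _ _)
      sizeA : ∀ {B′} → length B′ ≡ order u →
              length (Y ++ B′) ℕ.+ order t ≡ length Y ℕ.+ (order t ℕ.+ order u)
      sizeA |B′| = trans
        (cong (ℕ._+ order t) (trans (length-++ Y) (cong (length Y ℕ.+_) |B′|)))
        (trans (ℕₚ.+-assoc (length Y) _ _) (cong (length Y ℕ.+_) (ℕₚ.+-comm (order u) (order t))))

  -- Invariant of the execution and length of messages

  module Run {L : Set} (program : List (Instr L)) (q : ℕ) where
    open Execution (detector program q) N

    symbolic : ℕ → List (Instr L) × List (Tree L)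
    symbolic = fold (program , []) stepTree

    record Tracks (z : List (Instr L) × List (Tree L)) (v : Fin n) (σ : Memory L) : Set where
      constructor tracks
      field
        self≡    : self σ ≡ code v
        program≡ : proj₁ (machine σ) ≡ proj₁ z
        stack    : Pointwise (Represents q v) (proj₂ z) (proj₂ (machine σ))

    open Tracks

    top-represents : ∀ {p u s v σ} → Tracks (p , u ∷ s) v σ → Represents q v u (current σ)
    top-represents (tracks _ _ (r ∷ _)) = r

    -- Since all nodes share the symbolic stack, at a `join` the messages represent the child `u` at
    -- the neighbours, while the node's second entry represents `t` at the node itself. Its own
    -- family for `u` is dropped.
    step-tracks : ∀ {z v} {σ : Memory L} {H : Fin (deg v) → Family} →
      Tracks z v σ →
      (∀ {p u s} → z ≡ (p , u ∷ s) → ∀ i → Represents q (nbr v i) u (H i)) →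
      Tracks (stepTree z) v (memory (self σ)
        (step (λ _ → [ [ self σ ] ])
              (λ F _ → represent q (disjointUnions F (concatMap H (allFin (deg v)))))
              (machine σ)))
    step-tracks {[]         , _}     (tracks refl refl rs) _ = tracks refl refl rs
    step-tracks {push x ∷ p , _}     (tracks refl refl rs) _ = tracks refl refl (leaf-represents x ∷ rs)
    step-tracks {join   ∷ p , []}    (tracks refl refl []) _ = tracks refl refl []
    step-tracks {join   ∷ p , _ ∷ []} (tracks refl refl (r ∷ [])) _ = tracks refl refl (r ∷ [])
    step-tracks {join   ∷ p , u ∷ t ∷ s} (tracks refl refl (_ ∷ r ∷ rs)) received =
      tracks refl refl (graft-represents r (received refl) ∷ rs)

    round-tracks : ∀ {z} {σ : Config} → (∀ v → Tracks z v (σ v)) →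
                   Surely (λ τ → ∀ v → Tracks (stepTree z) v (τ v)) (round σ)
    round-tracks {z} {σ} tr = Surely-independently {P = Tracks (stepTree z)} _ λ v →
      step-tracks (tr v) λ { refl i →
        subst (Represents q (nbr v i) _) (sym (decode-encode (current (σ (nbr v i)))))
          (top-represents (tr (nbr v i))) }

    run-tracks : ∀ r → Surely (λ σ → ∀ v → Tracks (symbolic r) v (σ v)) (run r)
    run-tracks ℕ.zero    =
      Surely-independently {P = Tracks (program , [])} _ λ v → tracks refl refl []
    run-tracks (ℕ.suc r) = Surely->>= round-tracks (run r) (run-tracks r)

    encode-current-bound : ∀ {z v} {σ : Memory L} → Tracks z v σ → orders (proj₂ z) ℕ.≤ q →
                           length (encode (current σ)) ℕ.≤ messageBits q b ℕ.* logBits n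
    encode-current-bound {_ , []}    (tracks _ _ [])      _     = ℕ.z≤n
    encode-current-bound {_ , u ∷ s} {v} {σ} (tracks _ _ (r ∷ _)) fits = begin
      length (encode (current σ))
        ≤⟨ length-encode (current σ) (All.tabulate λ A∈ →
             ℕₚ.≤-trans (ℕₚ.≤-reflexive (length-Embeds (sound r A∈))) |u|≤q
           , All.map (λ { (w , refl) → size-fromℕ (b ℕ.* logBits n) (ident-bound w) })
                     (Embeds-codes (sound r A∈))) ⟩
      length (current σ) ℕ.* (2 ℕ.+ q ℕ.* (2 ℕ.+ 2 ℕ.* (b ℕ.* logBits n)))
        ≤⟨ ℕₚ.*-mono-≤
             (ℕₚ.≤-trans (small r) (ℕₚ.^-monoˡ-≤ q (ℕ.s≤s |u|≤q)))
             (scale-+ 2 (q ℕ.* (2 ℕ.+ 2 ℕ.* b)) (scale-* q (2 ℕ.+ 2 ℕ.* b)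
               (scale-+ 2 (2 ℕ.* b) (scale-* 2 b ℕₚ.≤-refl)))) ⟩
      ℕ.suc q ℕ.^ q ℕ.* ((2 ℕ.+ q ℕ.* (2 ℕ.+ 2 ℕ.* b)) ℕ.* logBits n)
        ≡⟨ ℕₚ.*-assoc (ℕ.suc q ℕ.^ q) _ (logBits n) ⟨
      messageBits q b ℕ.* logBits n ∎
      where
      open ℕₚ.≤-Reasoning
      |u|≤q : order u ℕ.≤ q
      |u|≤q = ℕₚ.≤-trans (ℕₚ.m≤m+n _ _) fits
      -- Additive constants are absorbed because `logBits n` is at least 1.
      scale-+ : ∀ a y {x} → x ℕ.≤ y ℕ.* logBits n → a ℕ.+ x ℕ.≤ (a ℕ.+ y) ℕ.* logBits n
      scale-+ a y x≤ = ℕₚ.≤-trans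
        (ℕₚ.+-mono-≤ (ℕₚ.m≤m*n a (logBits n) {{ℕ.>-nonZero (1≤logBits v)}}) x≤)
        (ℕₚ.≤-reflexive (sym (ℕₚ.*-distribʳ-+ (logBits n) a y)))
      scale-* : ∀ a y {x} → x ℕ.≤ y ℕ.* logBits n → a ℕ.* x ℕ.≤ (a ℕ.* y) ℕ.* logBits n
      scale-* a y x≤ = ℕₚ.≤-trans (ℕₚ.*-monoʳ-≤ a x≤)
        (ℕₚ.≤-reflexive (sym (ℕₚ.*-assoc a y (logBits n))))

    bandwidth : Bandwidth q (messageBits q b)
    bandwidth r r<q = Surely-mono
      (λ tr v _ → encode-current-bound (tr v)
        (ℕₚ.≤-trans (orders-fold program r) (ℕₚ.<⇒≤ r<q)))
      (run r) (run-tracks r)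

  module _ {L : Set} (t : Tree L) where
    private
      q = time t
      program = compile t []

    open Execution (detector program q) N
    open Run program q

    -- The final symbolic stack is `t` alone. This lets the number of rounds serve as the budget `q`
    -- too.
    order≤time : order t ℕ.≤ q
    order≤time = ℕₚ.≤-trans (ℕₚ.m≤m+n _ _)
      (subst (λ z → orders (proj₂ z) ℕ.≤ q) (compile-correct t [] []) (orders-fold program q))

    run-represents : Surely (λ σ → ∀ v → Represents q v t (current (σ v))) (run q)
    run-represents = Surely-mono
      (λ tr v → top-represents (subst (λ z → Tracks z v _) (compile-correct t [] []) (tr v)))
      (run q) (run-tracks q)

    no-embedding⇒accepts : (∀ {v A} → ¬ Embeds t v A) → Surely AllAccept (run q)
    no-embedding⇒accepts none = Surely-mono (λ {σ} rep v → empty (rep v)) (run q) run-represents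
      where
      empty : ∀ {v F} → Represents q v t F → verdict F ≡ accept
      empty {F = []}    _ = refl
      empty {F = _ ∷ _} r = ⊥-elim (none (sound r (here refl)))

    -- Completeness for empty `Y` says just that the family at the image of the root is nonempty.
    embedding⇒rejects : ∀ {v A} → Embeds t v A → Surely SomeReject (run q)
    embedding⇒rejects {v} {A} e =
      Surely-mono (λ {σ} rep → v , nonempty (rep v)) (run q) run-represents
      where
      nonempty : ∀ {F} → Represents q v t F → verdict F ≡ reject
      nonempty {[]} r = case complete r [] e order≤time (λ ()) of λ { (_ , () , _) }
      nonempty {_ ∷ _} _ = refl

  -- Embeddings as maps on vertices

  map⇒Embeds : ∀ {t : Tree (Fin k)} {f} → Injective _≡_ _≡_ f → Separated t →
               (∀ {x y} → Edge t x y → Graph.Adj G (f x) (f y)) →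
               Embeds t (f (root t)) (map (code ∘ f) (labels t))
  map⇒Embeds {t = leaf x} inj _ hom = leaf x _
  map⇒Embeds {t = graft t u} {f} inj (sep-t , sep-u , t#u) hom =
    subst (Embeds _ _) (sym (map-++ (code ∘ f) (labels t) (labels u)))
      (graft (map⇒Embeds inj sep-t (hom ∘ inj₁)) (map⇒Embeds inj sep-u (hom ∘ inj₂ ∘ inj₁))
             (hom (inj₂ (inj₂ (refl , refl)))) disjoint)
    where
    disjoint : Disjoint (map (code ∘ f) (labels t)) (map (code ∘ f) (labels u))
    disjoint (a∈ , b∈) with ∈-map⁻ (code ∘ f) a∈ | ∈-map⁻ (code ∘ f) b∈
    ... | x , x∈ , refl | y , y∈ , e with inj (code-injective e)
    ... | refl = t#u (x∈ , y∈)

  -- The maps of the two parts are arbitrary off their labels, so they are glued by testing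
  -- membership in `labels t`; separation ensures that `g` is the one used on `labels u`.
  Embeds⇒map : ∀ {t : Tree (Fin k)} {v A} → Separated t → Embeds t v A →
               ∃[ f ] f (root t) ≡ v × map (code ∘ f) (labels t) ≡ A ×
                      (∀ {x y} → Edge t x y → Graph.Adj G (f x) (f y))
  Embeds⇒map _ (leaf x v) = (λ _ → v) , refl , refl , λ ()
  Embeds⇒map {k} (sep-t , sep-u , t#u) (graft {t} {u} eA eB v~w A#B)
    with Embeds⇒map sep-t eA | Embeds⇒map sep-u eB
  ... | f , refl , refl , hom-f | g , refl , refl , hom-g =
    h , h≡f (root∈labels t)
      , trans (map-++ (code ∘ h) (labels t) (labels u))
          (cong₂ _++_ (map-cong-local (All.tabulate (cong code ∘ h≡f)))
                      (map-cong-local (All.tabulate (cong code ∘ h≡g))))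
      , hom
    where
    open import Data.List.Membership.DecPropositional (_≟ᶠ_ {k}) using () renaming (_∈?_ to _∈ᶠ?_)
    h : Fin k → Fin n
    h x with x ∈ᶠ? labels t
    ... | yes _ = f x
    ... | no  _ = g x
    h≡f : ∀ {x} → x ∈ labels t → h x ≡ f x
    h≡f {x} x∈t with x ∈ᶠ? labels t
    ... | yes _  = refl
    ... | no x∉t = contradiction x∈t x∉t
    h≡g : ∀ {x} → x ∈ labels u → h x ≡ g x
    h≡g {x} x∈u with x ∈ᶠ? labels t
    ... | yes x∈t = ⊥-elim (t#u (x∈t , x∈u))
    ... | no _    = refl
    hom : ∀ {x y} → Edge (graft t u) x y → Graph.Adj G (h x) (h y)
    hom (inj₁ e) with Edge⇒∈labels t e
    ... | x∈ , y∈ rewrite h≡f x∈ | h≡f y∈ = hom-f e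
    hom (inj₂ (inj₁ e)) with Edge⇒∈labels u e
    ... | x∈ , y∈ rewrite h≡g x∈ | h≡g y∈ = hom-g e
    hom (inj₂ (inj₂ (refl , refl)))
      rewrite h≡f (root∈labels t) | h≡g (root∈labels u) = v~w

-- Spanning trees

module Spanning {k} (T : Graph k) where
  open Graph T renaming (sym to symᵀ)
  open import Data.List.Membership.DecPropositional (_≟ᶠ_ {k}) using () renaming (_∈?_ to _∈ᶠ?_)

  infixr 5 _∷_

  data Path : Fin k → Fin k → List (Fin k) → Set where
    trivial : ∀ x → Path x x (x ∷ [])
    _∷_ : ∀ {x y z xs} → Adj x y → Path y z xs → Path x z (x ∷ xs)

  Path-∷ʳ : ∀ {x y z xs} → Path x y xs → Adj y z → Path x z (xs ∷ʳ z)
  Path-∷ʳ (trivial _)   y~z = y~z ∷ trivial _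
  Path-∷ʳ (a ∷ p) y~z = a ∷ Path-∷ʳ p y~z

  -- For `w ≡ z` this is the closed walk that `IsCycle` asks for.
  Path⇒Linked : ∀ {w x y z xs} → Adj w x → Path x y xs → Adj y z → Linked Adj (w ∷ xs ∷ʳ z)
  Path⇒Linked w~x (trivial _)   y~z = w~x ∷ y~z ∷ [-]
  Path⇒Linked w~x (a ∷ p) y~z = w~x ∷ Path⇒Linked a p y~z

  2≤length-Path : ∀ {x y xs} → x ≢ y → Path x y xs → 2 ℕ.≤ length xs
  2≤length-Path x≢y (trivial _)         = contradiction refl x≢y
  2≤length-Path x≢y (_ ∷ (trivial _))   = ℕ.s≤s (ℕ.s≤s ℕ.z≤n)
  2≤length-Path x≢y (_ ∷ (_ ∷ _)) = ℕ.s≤s (ℕ.s≤s ℕ.z≤n)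

  -- The simple paths of `path` are carried along for the sake of `complete`: a second edge from a
  -- new vertex into `t` would close such a path to a cycle.
  record Spans (t : Tree (Fin k)) : Set where
    field
      separated : Separated t
      sound     : ∀ {x y} → Edge t x y → Adj x y
      complete  : ∀ {x y} → x ∈ labels t → y ∈ labels t → Adj x y → Edge t x y ⊎ Edge t y x
      path      : ∀ {x y} → x ∈ labels t → y ∈ labels t →
                  ∃[ xs ] Path x y xs × Unique xs × All (_∈ labels t) xs

  open Spans

  -- The membership proof steers the descent to the `leaf` that carries `u`, where `w` is hung as a
  -- child.
  insert : ∀ (t : Tree (Fin k)) {u} → u ∈ labels t → Fin k → Tree (Fin k)
  insert (leaf x)    _   w = graft (leaf x) (leaf w)
  insert (graft s t) u∈  w = [ (λ u∈s → graft (insert s u∈s w) t)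
                             , (λ u∈t → graft s (insert t u∈t w)) ]′ (∈-++⁻ (labels s) u∈)

  module _ {u w : Fin k} where

    root-insert : ∀ t (u∈ : u ∈ labels t) → root (insert t u∈ w) ≡ root t
    root-insert (leaf x)    u∈ = refl
    root-insert (graft s t) u∈ with ∈-++⁻ (labels s) u∈
    ... | inj₁ u∈s = root-insert s u∈s
    ... | inj₂ u∈t = refl

    labels-insert⁻ : ∀ t (u∈ : u ∈ labels t) {x} → x ∈ labels (insert t u∈ w) → x ∈ labels t ⊎ x ≡ w
    labels-insert⁻ (leaf y) u∈ (here e)         = inj₁ (here e)
    labels-insert⁻ (leaf y) u∈ (there (here e)) = inj₂ e
    labels-insert⁻ (graft s t) u∈ x∈ with ∈-++⁻ (labels s) u∈
    ... | inj₁ u∈s with ∈-++⁻ (labels (insert s u∈s w)) x∈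
    ...   | inj₂ x∈t = inj₁ (∈-++⁺ʳ (labels s) x∈t)
    ...   | inj₁ x∈s with labels-insert⁻ s u∈s x∈s
    ...     | inj₁ x∈s = inj₁ (∈-++⁺ˡ x∈s)
    ...     | inj₂ e   = inj₂ e
    labels-insert⁻ (graft s t) u∈ x∈ | inj₂ u∈t with ∈-++⁻ (labels s) x∈
    ...   | inj₁ x∈s = inj₁ (∈-++⁺ˡ x∈s)
    ...   | inj₂ x∈t with labels-insert⁻ t u∈t x∈t
    ...     | inj₁ x∈t = inj₁ (∈-++⁺ʳ (labels s) x∈t)
    ...     | inj₂ e   = inj₂ e

    labels-insert⁺ : ∀ t (u∈ : u ∈ labels t) → labels t ⊆ labels (insert t u∈ w)
    labels-insert⁺ (leaf y) u∈ (here e) = here e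
    labels-insert⁺ (graft s t) u∈ x∈ with ∈-++⁻ (labels s) u∈ | ∈-++⁻ (labels s) x∈
    ... | inj₁ u∈s | inj₁ x∈s = ∈-++⁺ˡ (labels-insert⁺ s u∈s x∈s)
    ... | inj₁ u∈s | inj₂ x∈t = ∈-++⁺ʳ (labels (insert s u∈s w)) x∈t
    ... | inj₂ u∈t | inj₁ x∈s = ∈-++⁺ˡ x∈s
    ... | inj₂ u∈t | inj₂ x∈t = ∈-++⁺ʳ (labels s) (labels-insert⁺ t u∈t x∈t)

    w∈labels-insert : ∀ t (u∈ : u ∈ labels t) → w ∈ labels (insert t u∈ w)
    w∈labels-insert (leaf y) u∈ = there (here refl)
    w∈labels-insert (graft s t) u∈ with ∈-++⁻ (labels s) u∈
    ... | inj₁ u∈s = ∈-++⁺ˡ (w∈labels-insert s u∈s)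
    ... | inj₂ u∈t = ∈-++⁺ʳ (labels s) (w∈labels-insert t u∈t)

    Separated-insert : ∀ t (u∈ : u ∈ labels t) → w ∉ labels t → Separated t → Separated (insert t u∈ w)
    Separated-insert (leaf y) u∈ w∉ _ = tt , tt , λ { (here e , here e′) → w∉ (here (trans (sym e′) e)) }
    Separated-insert (graft s t) u∈ w∉ (sep-s , sep-t , s#t) with ∈-++⁻ (labels s) u∈
    ... | inj₁ u∈s = Separated-insert s u∈s (w∉ ∘ ∈-++⁺ˡ) sep-s , sep-t , λ (x∈s , x∈t) →
      [ (λ x∈s → s#t (x∈s , x∈t)) , (λ { refl → w∉ (∈-++⁺ʳ (labels s) x∈t) }) ]′ (labels-insert⁻ s u∈s x∈s)
    ... | inj₂ u∈t = sep-s , Separated-insert t u∈t (w∉ ∘ ∈-++⁺ʳ (labels s)) sep-t , λ (x∈s , x∈t) →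
      [ (λ x∈t → s#t (x∈s , x∈t)) , (λ { refl → w∉ (∈-++⁺ˡ x∈s) }) ]′ (labels-insert⁻ t u∈t x∈t)

    Edge-insert⁻ : ∀ t (u∈ : u ∈ labels t) {x y} → Edge (insert t u∈ w) x y → Edge t x y ⊎ (x ≡ u × y ≡ w)
    Edge-insert⁻ (leaf _) (here refl) (inj₂ (inj₂ e)) = inj₂ e
    Edge-insert⁻ (graft s t) u∈ e with ∈-++⁻ (labels s) u∈
    Edge-insert⁻ (graft s t) u∈ (inj₁ e) | inj₁ u∈s =
      [ inj₁ ∘ inj₁ , inj₂ ]′ (Edge-insert⁻ s u∈s e)
    Edge-insert⁻ (graft s t) u∈ (inj₂ (inj₁ e)) | inj₁ u∈s = inj₁ (inj₂ (inj₁ e))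
    Edge-insert⁻ (graft s t) u∈ (inj₂ (inj₂ (e , e′))) | inj₁ u∈s =
      inj₁ (inj₂ (inj₂ (trans e (root-insert s u∈s) , e′)))
    Edge-insert⁻ (graft s t) u∈ (inj₁ e) | inj₂ u∈t = inj₁ (inj₁ e)
    Edge-insert⁻ (graft s t) u∈ (inj₂ (inj₁ e)) | inj₂ u∈t =
      [ inj₁ ∘ inj₂ ∘ inj₁ , inj₂ ]′ (Edge-insert⁻ t u∈t e)
    Edge-insert⁻ (graft s t) u∈ (inj₂ (inj₂ (e , e′))) | inj₂ u∈t =
      inj₁ (inj₂ (inj₂ (e , trans e′ (root-insert t u∈t))))

    Edge-insert⁺ : ∀ t (u∈ : u ∈ labels t) {x y} → Edge t x y → Edge (insert t u∈ w) x y
    Edge-insert⁺ (graft s t) u∈ e with ∈-++⁻ (labels s) u∈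
    Edge-insert⁺ (graft s t) u∈ (inj₁ e) | inj₁ u∈s = inj₁ (Edge-insert⁺ s u∈s e)
    Edge-insert⁺ (graft s t) u∈ (inj₂ (inj₁ e)) | inj₁ u∈s = inj₂ (inj₁ e)
    Edge-insert⁺ (graft s t) u∈ (inj₂ (inj₂ (e , e′))) | inj₁ u∈s =
      inj₂ (inj₂ (trans e (sym (root-insert s u∈s)) , e′))
    Edge-insert⁺ (graft s t) u∈ (inj₁ e) | inj₂ u∈t = inj₁ e
    Edge-insert⁺ (graft s t) u∈ (inj₂ (inj₁ e)) | inj₂ u∈t = inj₂ (inj₁ (Edge-insert⁺ t u∈t e))
    Edge-insert⁺ (graft s t) u∈ (inj₂ (inj₂ (e , e′))) | inj₂ u∈t =
      inj₂ (inj₂ (e , trans e′ (sym (root-insert t u∈t))))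

    uw∈insert : ∀ t (u∈ : u ∈ labels t) → Edge (insert t u∈ w) u w
    uw∈insert (leaf _) (here refl) = inj₂ (inj₂ (refl , refl))
    uw∈insert (graft s t) u∈ with ∈-++⁻ (labels s) u∈
    ... | inj₁ u∈s = inj₁ (uw∈insert s u∈s)
    ... | inj₂ u∈t = inj₂ (inj₁ (uw∈insert t u∈t))

  leaf-spans : ∀ x → Spans (leaf x)
  leaf-spans x = record
    { separated = tt
    ; sound     = λ ()
    ; complete  = λ { (here refl) (here refl) x~x → contradiction x~x irrefl }
    ; path      = λ { (here refl) (here refl) → _ , trivial x , [] ∷ [] , here refl ∷ [] }
    }

  module _ (tree : IsTree T) where
    open IsTree tree

    -- Two neighbours of w in t, joined by a path inside t, would close a cycle.
    attachment-unique : ∀ {t u u′ w} → Spans t → w ∉ labels t →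
                        u ∈ labels t → u′ ∈ labels t → Adj u w → Adj u′ w → u ≡ u′
    attachment-unique {t} {u} {u′} {w} sp w∉ u∈ u′∈ u~w u′~w with u ≟ᶠ u′
    ... | yes u≡u′ = u≡u′
    ... | no  u≢u′ with path sp u∈ u′∈
    ... | xs , p , unique , xs⊆t = ⊥-elim (acyclic w xs
      ( 2≤length-Path u≢u′ p
      , All.map (λ { x∈ refl → w∉ x∈ }) xs⊆t ∷ unique
      , Path⇒Linked (symᵀ u~w) p u′~w ))

    insert-spans : ∀ {t u w} → Spans t → (u∈ : u ∈ labels t) → w ∉ labels t → Adj u w →
                   Spans (insert t u∈ w)
    insert-spans {t} {u} {w} sp u∈ w∉ u~w = record
      { separated = Separated-insert t u∈ w∉ (separated sp)
      ; sound     = λ e → [ sound sp , (λ { (refl , refl) → u~w }) ]′ (Edge-insert⁻ t u∈ e)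
      ; complete  = λ x∈ y∈ → complete′ (labels-insert⁻ t u∈ x∈) (labels-insert⁻ t u∈ y∈)
      ; path      = λ x∈ y∈ → path′ (labels-insert⁻ t u∈ x∈) (labels-insert⁻ t u∈ y∈)
      }
      where
      t′ = insert t u∈ w
      w∈ = w∈labels-insert t u∈
      uw = uw∈insert t u∈

      complete′ : ∀ {x y} → x ∈ labels t ⊎ x ≡ w → y ∈ labels t ⊎ y ≡ w →
                  Adj x y → Edge t′ x y ⊎ Edge t′ y x
      complete′ (inj₁ x∈) (inj₁ y∈) x~y =
        [ inj₁ ∘ Edge-insert⁺ t u∈ , inj₂ ∘ Edge-insert⁺ t u∈ ]′ (complete sp x∈ y∈ x~y)
      -- Every neighbour of `w` in `t` is `u`, so the edge just added is the only one required.
      complete′ (inj₁ x∈) (inj₂ refl) x~w with attachment-unique sp w∉ u∈ x∈ u~w x~w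
      ... | refl = inj₁ uw
      complete′ (inj₂ refl) (inj₁ y∈) w~y with attachment-unique sp w∉ u∈ y∈ u~w (symᵀ w~y)
      ... | refl = inj₂ uw
      complete′ (inj₂ refl) (inj₂ refl) w~w = contradiction w~w irrefl

      path′ : ∀ {x y} → x ∈ labels t ⊎ x ≡ w → y ∈ labels t ⊎ y ≡ w →
              ∃[ xs ] Path x y xs × Unique xs × All (_∈ labels t′) xs
      path′ (inj₁ x∈) (inj₁ y∈) =
        let xs , p , xs! , xs⊆t = path sp x∈ y∈
        in xs , p , xs! , All.map (labels-insert⁺ t u∈) xs⊆t
      path′ (inj₁ x∈) (inj₂ refl) =
        let xs , p , xs! , xs⊆t = path sp x∈ u∈
        in xs ∷ʳ w , Path-∷ʳ p u~w
         , Uniqueₚ.++⁺ xs! ([] ∷ []) (λ { (w∈xs , here refl) → w∉ (All.lookup xs⊆t w∈xs) })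
         , Allₚ.++⁺ (All.map (labels-insert⁺ t u∈) xs⊆t) (w∈ ∷ [])
      path′ (inj₂ refl) (inj₁ y∈) =
        let xs , p , xs! , xs⊆t = path sp u∈ y∈
        in w ∷ xs , symᵀ u~w ∷ p
         , All.map (λ { x∈ refl → w∉ x∈ }) xs⊆t ∷ xs!
         , w∈ ∷ All.map (labels-insert⁺ t u∈) xs⊆t
      path′ (inj₂ refl) (inj₂ refl) = _ , trivial w , [] ∷ [] , w∈ ∷ []

    -- Each vertex of the walk is either in the tree already or new and adjacent to its predecessor,
    -- which is in the tree; in the latter case it is inserted.
    grow-along : ∀ {t u w} → Star Adj u w → Spans t → u ∈ labels t →
                 ∃[ t′ ] Spans t′ × labels t ⊆ labels t′ × w ∈ labels t′
    grow-along ε sp u∈ = _ , sp , (λ x∈ → x∈) , u∈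
    grow-along {t} (_◅_ {j = x} u~x x⇝w) sp u∈ with x ∈ᶠ? labels t
    ... | yes x∈ = grow-along x⇝w sp x∈
    ... | no x∉ =
      let t′ , sp′ , ⊆t′ , w∈ = grow-along x⇝w (insert-spans sp u∈ x∉ u~x) (w∈labels-insert t u∈)
      in t′ , sp′ , ⊆t′ ∘ labels-insert⁺ t u∈ , w∈

    grow : ∀ {t} → Spans t → ∀ xs → ∃[ t′ ] Spans t′ × labels t ⊆ labels t′ × All (_∈ labels t′) xs
    grow {t} sp [] = t , sp , (λ x∈ → x∈) , []
    grow {t} sp (x ∷ xs) =
      let t₁ , sp₁ , ⊆t₁ , x∈  = grow-along (connected (root t) x) sp (root∈labels t)
          t₂ , sp₂ , ⊆t₂ , xs⊆ = grow sp₁ xs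
      in t₂ , sp₂ , ⊆t₂ ∘ ⊆t₁ , ⊆t₂ x∈ ∷ xs⊆

    spanning : ∃[ t ] Spans t × (∀ x → x ∈ labels t)
    spanning =
      -- Any vertex can be the root; `nonempty` provides vertex 0.
      let t , sp , _ , all = grow (leaf-spans (fromℕ< nonempty)) (allFin k)
      in t , sp , λ x → All.lookup all (∈-allFin x)

-- Copies of `T` versus embeddings of its spanning tree, and the theorem

module _ {T : Graph k} {t : Tree (Fin k)} (sp : Spanning.Spans T t) (full : ∀ x → x ∈ labels t)
         {b n} {G : Graph n} (N : Network b G) where
  open Correctness N
  open Spanning.Spans sp

  Contains⇒Embeds : G Contains T → ∃₂ (Embeds t)
  Contains⇒Embeds (H , iso) = _ , _ , map⇒Embeds (_≅_.injective iso) separated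
    λ {x} {y} e → Subgraph.sound H (Equivalence.to (_≅_.preserving iso x y) (sound e))

  -- The subgraph is the image of `T`. Its edges lie in `G` because `complete` makes each edge of
  -- `T` an edge of `t`, and they reflect back to `T` because `f` is injective.
  Embeds⇒Contains : ∀ {v A} → Embeds t v A → G Contains T
  Embeds⇒Contains e with Embeds⇒map separated e
  ... | f , refl , refl , hom = image , record
    { f          = f
    ; injective  = f-injective
    ; into       = λ i → i , refl
    ; onto       = λ v∈ → v∈
    ; preserving = λ i j → mk⇔
        (λ i~j → i , j , i~j , refl , refl)
        λ (i′ , j′ , i′~j′ , fi′ , fj′) → preserved i′~j′ (f-injective fi′) (f-injective fj′)
    }
    where
    preserved : ∀ {i j i′ j′} → Graph.Adj T i′ j′ → i′ ≡ i → j′ ≡ j → Graph.Adj T i j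
    preserved a refl refl = a

    -- The list of identifiers has no repetition, and by `full` it has an entry for every vertex of
    -- `T`.
    f-injective : Injective _≡_ _≡_ f
    f-injective {x} {y} fx≡fy
      with ∈-AllPairs₂ (AllPairsₚ.map⁻ (Embeds-unique e)) (full x) (full y)
    ... | inj₁ x≡y         = x≡y
    ... | inj₂ (inj₁ cx≢cy) = contradiction (cong code fx≡fy) cx≢cy
    ... | inj₂ (inj₂ cy≢cx) = contradiction (cong code (sym fx≡fy)) cy≢cx

    image : Subgraph G
    image = record
      { Vertex = λ v → ∃[ i ] f i ≡ v
      ; Edge   = λ v w → ∃[ i ] ∃[ j ] Graph.Adj T i j × f i ≡ v × f j ≡ w
      ; sym    = λ (i , j , i~j , e₁ , e₂) → j , i , Graph.sym T i~j , e₂ , e₁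
      ; ends   = λ (i , j , _ , e₁ , e₂) → (i , e₁) , (j , e₂)
      ; sound  = λ { (i , j , i~j , refl , refl) →
          [ hom , Graph.sym G ∘ hom ]′ (complete (full i) (full j) i~j) }
      }

mainTheorem2 : ∀ {k : ℕ} (T : Graph k) → IsTree T →
    ∃[ R ] (∀ (b : ℕ) →
    Σ[ A ∈ Algorithm ] ∃[ c ]
    (∀ {n : ℕ} (G : Graph n) (N : Network b G) →
    let open Execution A N in
    Bandwidth R c
    × (G FreeOf T → + 2 / 3 ≤ Pr allAccept? (run R))
    × (G Contains T → + 2 / 3 ≤ Pr someReject? (run R))))
mainTheorem2 T tree with Spanning.spanning T tree
-- Rounds and program depend on `T` alone; `b` enters only the bandwidth constant.
... | t , sp , full = time t , λ b →
  detector (compile t []) (time t) , messageBits (time t) b , λ G N →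
    let open Execution (detector (compile t []) (time t)) N
        open Correctness N
    in Run.bandwidth (compile t []) (time t)
     , (λ free → Surely⇒2/3≤Pr allAccept? (run (time t))
         (no-embedding⇒accepts t (free ∘ Embeds⇒Contains sp full N)))
     , (λ contains → let _ , _ , e = Contains⇒Embeds sp full N contains in
         Surely⇒2/3≤Pr someReject? (run (time t)) (embedding⇒rejects t e))
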